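{- For any zero-set $\mathcal{Z}$, with $s=s(\mathcal{Z})$, $\mu_{\mathrm{en}}(\mathcal{Z})\le 4s+1$ and $\mu_{\mathrm{th}}(\mathcal{Z})\le 8s+2$. Moreover, $\sup_{\mathcal{Z}\neq\emptyset}\mu_{\mathrm{en}}(\mathcal{Z})/s(\mathcal{Z})\in(0,\infty)$ and $\sup_{\mathcal{Z}\neq\emptyset}\mu_{\mathrm{th}}(\mathcal{Z})/s(\mathcal{Z})\in(0,\infty)$, where the suprema are over all nonempty zero-sets.
   Context: $\mathbb{Z}_+=\{0,1,2,\dots\}$, $\mathbb{N}=\{1,2,\dots\}$. For $a,b\in\mathbb{N}$, $R_{a,b}=([0,a-1]\times[0,b-1])\cap\mathbb{Z}_+^2$, and $R_{0,0}=\emptyset$. A zero-set is a union $\mathcal{Z}=\bigcup_{(a,b)\in\mathcal{I}}R_{a,b}$ over a finite $\mathcal{I}\subseteq\mathbb{N}^2$ (possibly empty). $s(\mathcal{Z})$ is the integer $s\ge0$ with $R_{s,s}\subseteq\mathcal{Z}$ but $R_{s+1,s+1}\not\subseteq\mathcal{Z}$. For $x\in\mathbb{Z}_+^2$, $L^h(x),L^v(x)$ are the horizontal and vertical lines through $x$; for $A\subseteq\mathbb{Z}_+^2$, $\mathtt{row}(x,A)=|L^h(x)\cap A|$, $\mathtt{col}(x,A)=|L^v(x)\cap A|$. Regular dynamics: $\mathcal{T}(A)=A\cup\{x\notin A:(\mathtt{row}(x,A),\mathtt{col}(x,A))\notin\mathcal{Z}\}$; $A$ spans if $\bigcup_t\mathcal{T}^t(A)=\mathbb{Z}_+^2$;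 for finite spanning $A$, $\tau(\mathcal{Z},A)=\min\{t\in\mathbb{N}:\mathcal{T}^t(A)=\mathbb{Z}_+^2\}$. A finite set $A$ is thin if for every $x\in A$, $\mathtt{row}(x,A)=1$ or $\mathtt{col}(x,A)=1$; $\mu_{\mathrm{th}}(\mathcal{Z})=\max\{\tau(\mathcal{Z},A):A\text{ thin and spanning}\}$. Enhanced dynamics: enhancements $\vec r=(r_0,r_1,\dots)$, $\vec c=(c_0,c_1,\dots)$ are weakly decreasing sequences of nonnegative integers; $\mathcal{T}_{\mathrm{en}}(A)=A\cup\{(i,j):(\mathtt{row}((i,j),A)+r_j,\mathtt{col}((i,j),A)+c_i)\notin\mathcal{Z}\}$; $(\vec r,\vec c)$ spans for $\mathcal{Z}$ if $\bigcup_t\mathcal{T}_{\mathrm{en}}^t(\emptyset)=\mathbb{Z}_+^2$; $\tau_{\mathrm{en}}(\mathcal{Z},\vec r,\vec c)=\inf\{t\in\mathbb{N}:\mathcal{T}_{\mathrm{en}}^t(\emptyset)=\mathbb{Z}_+^2\}$; $\mu_{\mathrm{en}}(\mathcal{Z})$ is the maximum of $\tau_{\mathrm{en}}(\mathcal{Z},\vec r,\vec c)$ over spanning pairs with finite support. -}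

module Defs where

open import Data.Nat using (ℕ; zero; suc; _+_; _*_; _∸_; _≤_; _<_; _≟_)
open import Data.Product using (Σ; _×_; _,_; proj₁; proj₂)
open import Data.Sum using (_⊎_)
open import Data.List using (List; []; _∷_; length; filter)
open import Data.List.Relation.Unary.All using (All)
open import Data.List.Relation.Unary.Any using (Any)
open import Data.List.Relation.Unary.Unique.Propositional using (Unique)
open import Data.List.Membership.Propositional using (_∈_)
open import Relation.Binary.PropositionalEquality using (_≡_)
open import Relation.Nullary using (¬_)
open import Data.Empty using (⊥)

-- A lattice point (i , j) ∈ ℤ₊² ; i is the horizontal coordinate, j the vertical.
Point : Set
Point = ℕ × ℕ

Pred2 : Set₁
Pred2 = ℕ → ℕ → Set

IndexSet : Set
IndexSet = List (ℕ × ℕ)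

ValidIndexSet : IndexSet → Set
ValidIndexSet I = All (λ p → 1 ≤ proj₁ p × 1 ≤ proj₂ p) I

InZ : IndexSet → ℕ → ℕ → Set
InZ I x y = Any (λ p → x < proj₁ p × y < proj₂ p) I

NonemptyZ : IndexSet → Set
NonemptyZ I = Σ ℕ λ x → Σ ℕ λ y → InZ I x y

SquareIn : IndexSet → ℕ → Set
SquareIn I s = (x y : ℕ) → x < s → y < s → InZ I x y

IsS : IndexSet → ℕ → Set
IsS I s = SquareIn I s × ¬ SquareIn I (suc s)

-- Line counts for arbitrary (possibly infinite) sets, as thresholds.

RowAtLeast : Pred2 → ℕ → ℕ → Set
RowAtLeast B j k = Σ (List ℕ) λ l → Unique l × All (λ i' → B i' j) l × k ≤ length l

ColAtLeast : Pred2 → ℕ → ℕ → Set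
ColAtLeast B i k = Σ (List ℕ) λ l → Unique l × All (λ j' → B i j') l × k ≤ length l

NotInZCounts : IndexSet → Pred2 → ℕ → ℕ → Set
NotInZCounts I B i j = All (λ p → RowAtLeast B j (proj₁ p) ⊎ ColAtLeast B i (proj₂ p)) I

-- 𝓣(B) = B ∪ {x : (row(x,B), col(x,B)) ∉ 𝓩}
-- (points of B are already in B, so the restriction x ∉ B is immaterial)
Step : IndexSet → Pred2 → Pred2
Step I B i j = B i j ⊎ NotInZCounts I B i j

Iter : IndexSet → Pred2 → ℕ → Pred2
Iter I B zero = B
Iter I B (suc t) = Step I (Iter I B t)

Full : Pred2 → Set
Full B = (i j : ℕ) → B i j

-- finite sets are given as duplicate-free lists of points
ListSet : List Point → Pred2
ListSet A i j = (i , j) ∈ A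

Spans : IndexSet → List Point → Set
Spans I A = (i j : ℕ) → Σ ℕ λ t → Iter I (ListSet A) t i j

rowCount : Point → List Point → ℕ
rowCount (i , j) A = length (filter (λ p → proj₂ p ≟ j) A)

colCount : Point → List Point → ℕ
colCount (i , j) A = length (filter (λ p → proj₁ p ≟ i) A)

Thin : List Point → Set
Thin A = Unique A × All (λ x → rowCount x A ≡ 1 ⊎ colCount x A ≡ 1) A

WeaklyDecreasing : (ℕ → ℕ) → Set
WeaklyDecreasing r = (n : ℕ) → r (suc n) ≤ r n

FiniteSupport : (ℕ → ℕ) → Set
FiniteSupport r = Σ ℕ λ N → (n : ℕ) → N ≤ n → r n ≡ 0

-- (row((i,j),B) + r_j , col((i,j),B) + c_i) ∉ 𝓩 :
-- for every (a,b) ∈ 𝓘, row + r_j ≥ a (i.e. row ≥ a ∸ r_j) or col + c_i ≥ b.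
EnStep : IndexSet → (ℕ → ℕ) → (ℕ → ℕ) → Pred2 → Pred2
EnStep I r c B i j =
  B i j ⊎ All (λ p → RowAtLeast B j (proj₁ p ∸ r j) ⊎ ColAtLeast B i (proj₂ p ∸ c i)) I

EmptySet : Pred2
EmptySet i j = ⊥

EnIter : IndexSet → (ℕ → ℕ) → (ℕ → ℕ) → ℕ → Pred2
EnIter I r c zero = EmptySet
EnIter I r c (suc t) = EnStep I r c (EnIter I r c t)

EnSpans : IndexSet → (ℕ → ℕ) → (ℕ → ℕ) → Set
EnSpans I r c = (i j : ℕ) → Σ ℕ λ t → EnIter I r c t i j

AdmissibleEn : IndexSet → (ℕ → ℕ) → (ℕ → ℕ) → Set
AdmissibleEn I r c =
  WeaklyDecreasing r × WeaklyDecreasing c × FiniteSupport r × FiniteSupport c × EnSpans I r c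

-- μ_en(𝓩) ≤ T : every admissible pair has τ_en ≤ T, i.e. 𝓣_en^T(∅) = ℤ₊²
-- (dynamics is monotone in t, so τ_en ≤ T iff the T-th iterate is full).
MuEnAtMost : IndexSet → ℕ → Set
MuEnAtMost I T = (r c : ℕ → ℕ) → AdmissibleEn I r c → Full (EnIter I r c T)

MuThAtMost : IndexSet → ℕ → Set
MuThAtMost I T = (A : List Point) → Thin A → Spans I A → Full (Iter I (ListSet A) T)

{-# OPTIONS --safe #-}
module Submission where

open import Defs
open import Data.Nat using (ℕ; zero; suc; _+_; _*_; _∸_; _≤_; _<_; _≟_; _≤?_; _<?_; z≤n; s≤s)
open import Data.Nat.Properties
open import Data.Nat.Solver using (module +-*-Solver)
open import Data.Product using (Σ; ∃; _×_; _,_; proj₁; proj₂)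
open import Data.Product.Properties using (≡-dec)
open import Data.Sum using (_⊎_; inj₁; inj₂; [_,_]′; swap) renaming (map to map-⊎)
open import Data.List using (List; []; _∷_; _++_; length; filter; map; upTo; deduplicate)
open import Data.List.Properties using (length-++; length-++-sucʳ; length-upTo; length-filter; length-map)
open import Data.List.Extrema.Nat using (max; xs≤max)
open import Data.List.Relation.Unary.All using (All; []; _∷_; lookup; tabulate) renaming (map to All-map)
open import Data.List.Relation.Unary.All.Properties using (¬Any⇒All¬)
open import Data.List.Relation.Unary.Any using (here; there) renaming (map to Any-map)
open import Data.List.Relation.Unary.AllPairs using ([]; _∷_)
open import Data.List.Relation.Unary.Unique.Propositional using (Unique)
open import Data.List.Relation.Unary.Unique.Propositional.Properties using (++⁺; upTo⁺; filter⁺)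
open import Data.List.Relation.Unary.Unique.DecPropositional.Properties _≟_ using (deduplicate-!)
open import Data.List.Relation.Binary.Subset.Propositional using (_⊆_)
open import Data.List.Membership.Propositional using (_∈_; _∉_; find)
open import Data.List.Membership.Propositional.Properties
open import Data.List.Membership.DecPropositional _≟_ using (_∈?_)
open import Data.List.Membership.DecPropositional (≡-dec _≟_ _≟_) using () renaming (_∈?_ to _∈ᵖ?_)
open import Relation.Binary.PropositionalEquality using (_≡_; refl; sym; trans; subst)
open import Relation.Nullary using (¬_; yes; no; contradiction; ¬?)
open import Function using (_∘_; flip)

-- Write out a b for (a , b) ∉ 𝓩, so that out s s.
--
-- Enhanced dynamics.  Spanning forces out (i + r j) (j + c i) at every (i , j), since a failure
-- would block the quadrant above (i , j) forever; conversely this gives (i , j) by time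
-- i + j + 1, so the s × s square is occupied by time 2s.  From then on, rows j < s are filled
-- in decreasing order of the column enhancements: (i , j) is occupied 1 + j + (s ∸ c i) steps
-- later, because the columns before the first one of level c i are already there.  The first s
-- rows, and likewise the first s columns, are full by time 4s, and out s s finishes.
--
-- Thin sets.  Spanning forces out (|X| + l) (|Y| + k) whenever X, Y are finite sets of columns
-- and rows such that k (resp. l) bounds the number of points of A outside Y (resp. X) on a
-- column outside X (resp. row outside Y).  Let X, Y be the s columns and rows richest in points
-- of A, or all those with at least two points if there are fewer.  By thinness A misses
-- X × Y, so no point of A is counted twice there, and the argument above makes the rows of Y
-- and the columns of X full by time 4s.  If |X| = |Y| = s, out s s finishes.  Otherwise, say,
-- all rows outside Y contain at most one point, and the columns are filled in decreasing
-- order of their number of points outside Y, two steps per level: the first step occupies the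
-- rows that meet A outside the columns already filled, the second one the rest of the column.

-- Counting with duplicate-free lists, and auxiliary arithmetic

length-mono-⊆ : ∀ {A : Set} {xs ys : List A} → Unique xs → xs ⊆ ys → length xs ≤ length ys
length-mono-⊆ [] _ = z≤n
length-mono-⊆ {xs = x ∷ xs} (x∉xs ∷ xs!) sub with ∈-∃++ (sub (here refl))
... | as , bs , refl = ≤-trans (s≤s (length-mono-⊆ xs! sub′)) (≤-reflexive (sym (length-++-sucʳ as x bs)))
  where
  sub′ : xs ⊆ as ++ bs
  sub′ y∈xs with ∈-++⁻ as (sub (there y∈xs))
  ... | inj₁ y∈as          = ∈-++⁺ˡ y∈as
  ... | inj₂ (here refl)   = contradiction refl (lookup x∉xs y∈xs)
  ... | inj₂ (there y∈bs)  = ∈-++⁺ʳ as y∈bs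

infixl 6 _∖_
_∖_ : List ℕ → List ℕ → List ℕ
xs ∖ ys = filter (λ x → ¬? (x ∈? ys)) xs

∈-∖⁺ : ∀ {x xs ys} → x ∈ xs → x ∉ ys → x ∈ xs ∖ ys
∈-∖⁺ {ys = ys} = ∈-filter⁺ (λ x → ¬? (x ∈? ys))

∈-∖⁻ : ∀ {x} xs ys → x ∈ xs ∖ ys → x ∈ xs × x ∉ ys
∈-∖⁻ xs ys = ∈-filter⁻ (λ x → ¬? (x ∈? ys)) {xs = xs}

∖-unique : ∀ {xs} ys → Unique xs → Unique (xs ∖ ys)
∖-unique ys = filter⁺ (λ x → ¬? (x ∈? ys))

length-∖ : ∀ xs ys → length (xs ∖ ys) ≤ length xs
length-∖ xs ys = length-filter (λ x → ¬? (x ∈? ys)) xs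

length-∖-antitone : ∀ {xs ys zs} → Unique xs → ys ⊆ zs → length (xs ∖ zs) ≤ length (xs ∖ ys)
length-∖-antitone {xs} {zs = zs} xs! ys⊆zs = length-mono-⊆ (∖-unique zs xs!) λ x∈ →
  let x∈xs , x∉zs = ∈-∖⁻ xs zs x∈ in ∈-∖⁺ x∈xs (x∉zs ∘ ys⊆zs)

nonempty⇒∃∈ : ∀ {xs : List ℕ} → 0 < length xs → ∃ (_∈ xs)
nonempty⇒∃∈ {_ ∷ _} _ = _ , here refl

no-elements⇒length≤0 : ∀ {xs : List ℕ} → (∀ x → x ∉ xs) → length xs ≤ 0
no-elements⇒length≤0 none = ≮⇒≥ λ 0<len → let x , x∈xs = nonempty⇒∃∈ 0<len in none x x∈xs

fresh : ∀ xs → ∃ (_∉ xs)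
fresh xs = suc (max 0 xs) , λ x∈xs → 1+n≰n (lookup (xs≤max 0 xs) x∈xs)

-- Makes `s ∸ level` the induction measure for filling times: levels are truncated at `s`, and a
-- higher level is strictly earlier as long as the lower one is below `s`.
∸-decreasing : ∀ {m n s} → m < n → m < s → s ∸ n < s ∸ m
∸-decreasing {m} {n} {s} m<n m<s with n ≤? s
... | yes n≤s = ∸-monoʳ-< m<n n≤s
... | no n≰s  = subst (_< s ∸ m) (sym (m≤n⇒m∸n≡0 (<⇒≤ (≰⇒> n≰s)))) (m<n⇒0<n∸m m<s)

monotone : ∀ {P : ℕ → Set} → (∀ t → P t → P (suc t)) → ∀ {t t′} → t ≤ t′ → P t → P t′
monotone {P} step {t} {t′} t≤t′ p = subst P (m∸n+n≡m t≤t′) (go (t′ ∸ t))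
  where
  go : ∀ n → P (n + t)
  go zero    = p
  go (suc n) = step _ (go n)

-- Enhanced dynamics: the bound from abstract growth axioms

record EnhancedGrowth (s : ℕ) : Set₁ where
  field
    out       : ℕ → ℕ → Set
    out-mono  : ∀ {a a′ b b′} → a ≤ a′ → b ≤ b′ → out a b → out a′ b′
    out-s     : out s s
    r c       : ℕ → ℕ
    r-dec     : WeaklyDecreasing r
    c-dec     : WeaklyDecreasing c
    B         : ℕ → ℕ → ℕ → Set
    B-suc     : ∀ t {i j} → B t i j → B (suc t) i j
    B-grow    : ∀ {t i j a b} → (∀ {i′} → i′ < a → B t i′ j) → (∀ {j′} → j′ < b → B t i j′) →
                out (a + r j) (b + c i) → B (suc t) i j
    corner    : ∀ i j → out (i + r j) (j + c i)

-- The axioms are symmetric in the two coordinates, so the result on the first `s` rows also serves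
-- the first `s` columns.
transpose-enhanced : ∀ {s} → EnhancedGrowth s → EnhancedGrowth s
transpose-enhanced G = record
  { out = flip out ; out-mono = flip out-mono ; out-s = out-s
  ; r = c ; c = r ; r-dec = c-dec ; c-dec = r-dec
  ; B = λ t i j → B t j i ; B-suc = λ t → B-suc t ; B-grow = λ p q → B-grow q p
  ; corner = λ i j → corner j i }
  where open EnhancedGrowth G

decreasing⇒antitone : ∀ {f} → WeaklyDecreasing f → ∀ {m n} → m ≤ n → f n ≤ f m
decreasing⇒antitone {f} dec {m} m≤n = monotone {λ x → f x ≤ f m} (λ x → ≤-trans (dec x)) m≤n ≤-refl

first-of-level : (f : ℕ → ℕ) → WeaklyDecreasing f →
                 ∀ n → Σ ℕ λ m → f m ≡ f n × (∀ {k} → k < m → f n < f k)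
first-of-level f dec zero = zero , refl , λ ()
first-of-level f dec (suc n) with f (suc n) ≟ f n | first-of-level f dec n
... | yes eq | m , fm≡fn , above = m , trans fm≡fn (sym eq) , λ k<m → subst (_< f _) (sym eq) (above k<m)
... | no neq | m , fm≡fn , above = suc n , refl , λ k<1+n → <-≤-trans (≤∧≢⇒< (dec n) neq) (decreasing⇒antitone dec (≤-pred k<1+n))

module EnhancedFilling {s : ℕ} (G : EnhancedGrowth s) where
  open EnhancedGrowth G

  B-mono : ∀ {i j t t′} → t ≤ t′ → B t i j → B t′ i j
  B-mono = monotone (λ t → B-suc t)

  below-antidiagonal : ∀ n {i j} → i + j < n → B n i j
  below-antidiagonal (suc n) {i} {j} (s≤s i+j≤n) = B-grow
    (λ i′<i → below-antidiagonal n (<-≤-trans (+-monoˡ-< j i′<i) i+j≤n))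
    (λ j′<j → below-antidiagonal n (<-≤-trans (+-monoʳ-< i j′<j) i+j≤n))
    (corner i j)

  bottom-rows : ∀ n {i j} → j < s → j + (s ∸ c i) < n → B (s + s + n) i j
  bottom-rows (suc n) {i} {j} j<s (s≤s bound) =
    subst (λ t → B t i j) (sym (+-suc (s + s) n)) occupied
    where
    column : ∀ {j′} → j′ < j → B (s + s + n) i j′
    column j′<j = bottom-rows n (<-trans j′<j j<s) (<-≤-trans (+-monoˡ-< (s ∸ c i) j′<j) bound)

    occupied : B (suc (s + s + n)) i j
    occupied with s ≤? c i
    -- Truncation hides differences between levels above `s`, so no earlier columns are available;
    -- the square filled by time `s + s` supplies the row count instead.
    ... | yes s≤ci = B-grow
      (λ i′<s → B-mono (m≤m+n (s + s) n) (below-antidiagonal (s + s) (+-mono-< i′<s j<s)))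
      column
      (out-mono (m≤m+n s (r j)) (≤-trans s≤ci (m≤n+m (c i) j)) out-s)
    ... | no s≰ci =
      let i₀ , ci₀≡ci , above = first-of-level c c-dec i in B-grow
      -- Only the columns before `i₀` are known to be full here. They suffice because `c i` equals
      -- `c i₀`, so the corner condition at `i₀` applies to column `i`.
      (λ i′<i₀ → bottom-rows n j<s
        (<-≤-trans (+-monoʳ-< j (∸-decreasing (above i′<i₀) (≰⇒> s≰ci))) bound))
      column
      (subst (λ k → out (i₀ + r j) (j + k)) ci₀≡ci (corner i₀ j))

  bottom-rows-full : ∀ {i j} → j < s → B (s + s + (s + s)) i j
  bottom-rows-full {i} j<s = bottom-rows (s + s) j<s (+-mono-<-≤ j<s (m∸n≤m s (c i)))

enhanced-full : ∀ {s} (G : EnhancedGrowth s) → Full (EnhancedGrowth.B G (4 * s + 1))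
enhanced-full {s} G i j = subst (λ t → B t i j) time (B-grow
  (λ i′<s → EnhancedFilling.bottom-rows-full (transpose-enhanced G) i′<s)
  (λ j′<s → EnhancedFilling.bottom-rows-full G j′<s)
  (out-mono (m≤m+n s (r j)) (m≤m+n s (c i)) out-s))
  where
  open EnhancedGrowth G
  time : suc (s + s + (s + s)) ≡ 4 * s + 1
  time = solve 1 (λ x → con 1 :+ (x :+ x :+ (x :+ x)) := con 4 :* x :+ con 1) refl s
    where open +-*-Solver


-- Greedy choice of the heaviest lines

-- The head is the latest greedy choice: heaviest among all indices outside the tail. Every tail is
-- thus an earlier stage of the selection, which is what inductions on the list exploit.
data Ranked (f : ℕ → ℕ) : List ℕ → Set where
  []     : Ranked f []
  ranked : ∀ {x xs} → x ∉ xs → 2 ≤ f x → (∀ {y} → y ∉ xs → f y ≤ f x) →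
           Ranked f xs → Ranked f (x ∷ xs)

module _ {f : ℕ → ℕ} where

  ranked⇒2≤ : ∀ {xs x} → Ranked f xs → x ∈ xs → 2 ≤ f x
  ranked⇒2≤ (ranked _ 2≤fx _ _) (here refl) = 2≤fx
  ranked⇒2≤ (ranked _ _ _ rk)   (there x∈)  = ranked⇒2≤ rk x∈

  ranked⇒unique : ∀ {xs} → Ranked f xs → Unique xs
  ranked⇒unique [] = []
  ranked⇒unique (ranked x∉xs _ _ rk) = tabulate (λ { y∈xs refl → x∉xs y∈xs }) ∷ ranked⇒unique rk

-- Either n indices of largest weight, or all the indices of weight at least 2.
Heaviest : (ℕ → ℕ) → ℕ → List ℕ → Set
Heaviest f n xs = Ranked f xs × (length xs ≡ n ⊎ length xs < n × (∀ {y} → y ∉ xs → f y ≤ 1))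

maximiser : (f : ℕ → ℕ) → ∀ xs → (∀ {y} → y ∈ xs → f y ≤ 1) ⊎
            (∃ λ x → x ∈ xs × 2 ≤ f x × (∀ {y} → y ∈ xs → f y ≤ f x))
maximiser f [] = inj₁ λ ()
maximiser f (x ∷ xs) with maximiser f xs
... | inj₁ light with f x ≤? 1
...   | yes fx≤1 = inj₁ λ { (here refl) → fx≤1 ; (there y∈xs) → light y∈xs }
...   | no  fx≰1 = inj₂ (x , here refl , ≰⇒> fx≰1 ,
                    λ { (here refl) → ≤-refl ; (there y∈xs) → ≤-trans (light y∈xs) (<⇒≤ (≰⇒> fx≰1)) })
maximiser f (x ∷ xs) | inj₂ (m , m∈xs , 2≤fm , max) with f x ≤? f m
...   | yes fx≤fm = inj₂ (m , there m∈xs , 2≤fm , λ { (here refl) → fx≤fm ; (there y∈xs) → max y∈xs })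
...   | no  fx≰fm = inj₂ (x , here refl , ≤-trans 2≤fm (<⇒≤ (≰⇒> fx≰fm)) ,
                     λ { (here refl) → ≤-refl ; (there y∈xs) → ≤-trans (max y∈xs) (<⇒≤ (≰⇒> fx≰fm)) })

heaviest : (f : ℕ → ℕ) (support : List ℕ) → (∀ {y} → 0 < f y → y ∈ support) →
           ∀ n → ∃ (Heaviest f n)
heaviest f support supported zero = [] , [] , inj₁ refl
heaviest f support supported (suc n) with heaviest f support supported n
... | xs , rk , inj₂ (len<n , light) = xs , rk , inj₂ (m<n⇒m<1+n len<n , light)
... | xs , rk , inj₁ refl with maximiser f (support ∖ xs)
...   | inj₁ light = xs , rk , inj₂ (≤-refl , light′)
  where
  light′ : ∀ {y} → y ∉ xs → f y ≤ 1
  light′ {y} y∉xs = ≮⇒≥ λ 1<fy →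
    <⇒≱ 1<fy (light (∈-∖⁺ (supported (<-trans (s≤s z≤n) 1<fy)) y∉xs))
...   | inj₂ (x , x∈ , 2≤fx , max) =
        x ∷ xs , ranked (proj₂ (∈-∖⁻ support xs x∈)) 2≤fx max′ rk , inj₁ refl
  where
  max′ : ∀ {y} → y ∉ xs → f y ≤ f x
  max′ {y} y∉xs with 0 <? f y
  ... | yes 0<fy = max (∈-∖⁺ (supported 0<fy) y∉xs)
  ... | no 0≮fy  = ≤-trans (≮⇒≥ 0≮fy) z≤n

-- Thin sets: the bound from abstract growth axioms

-- R j and C i list the points of A in row j and in column i.
record ThinGrowth (s : ℕ) : Set₁ where
  field
    out       : ℕ → ℕ → Set
    out-mono  : ∀ {a a′ b b′} → a ≤ a′ → b ≤ b′ → out a b → out a′ b′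
    out-s     : out s s
    R C       : ℕ → List ℕ
    R!        : ∀ j → Unique (R j)
    C!        : ∀ i → Unique (C i)
    R⇒C       : ∀ {i j} → i ∈ R j → j ∈ C i
    C⇒R       : ∀ {i j} → j ∈ C i → i ∈ R j
    thin      : ∀ {i j} → i ∈ R j → length (R j) ≤ 1 ⊎ length (C i) ≤ 1
    cols rows : List ℕ
    cols!     : Unique cols
    rows!     : Unique rows
    R⊆cols    : ∀ {i j} → i ∈ R j → i ∈ cols
    C⊆rows    : ∀ {i j} → j ∈ C i → j ∈ rows
    B         : ℕ → ℕ → ℕ → Set
    B-suc     : ∀ t {i j} → B t i j → B (suc t) i j
    B-grow    : ∀ {t i j X Y} → Unique X → Unique Y →
                (∀ {i′} → i′ ∈ X → B t i′ j) → (∀ {j′} → j′ ∈ Y → B t i j′) →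
                out (length X + length (R j ∖ X)) (length Y + length (C i ∖ Y)) → B (suc t) i j
    escape    : ∀ {X Y k l} → (∀ {i} → i ∉ X → length (C i ∖ Y) ≤ k) →
                (∀ {j} → j ∉ Y → length (R j ∖ X) ≤ l) → out (length X + l) (length Y + k)

transpose-thin : ∀ {s} → ThinGrowth s → ThinGrowth s
transpose-thin G = record
  { out = flip out ; out-mono = flip out-mono ; out-s = out-s
  ; R = C ; C = R ; R! = C! ; C! = R! ; R⇒C = C⇒R ; C⇒R = R⇒C ; thin = swap ∘ thin ∘ C⇒R
  ; cols = rows ; rows = cols ; cols! = rows! ; rows! = cols! ; R⊆cols = C⊆rows ; C⊆rows = R⊆cols
  ; B = λ t i j → B t j i ; B-suc = λ t → B-suc t
  ; B-grow = λ X! Y! p q → B-grow Y! X! q p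
  ; escape = λ p q → escape q p }
  where open ThinGrowth G

module ThinFilling {s : ℕ} (G : ThinGrowth s) where
  open ThinGrowth G

  rowWeight colWeight : ℕ → ℕ
  rowWeight j = length (R j)
  colWeight i = length (C i)

  B-mono : ∀ {i j t t′} → t ≤ t′ → B t i j → B t′ i j
  B-mono = monotone (λ t → B-suc t)

  -- By thinness a point of A in a row with two points is alone in its column, so it lies on no
  -- heavy column, and removing `X` loses nothing.
  heavy-columns-avoid : ∀ {j X} → 2 ≤ rowWeight j → (∀ {i} → i ∈ X → 2 ≤ colWeight i) →
                        rowWeight j ≤ length (R j ∖ X)
  heavy-columns-avoid {j} {X} 2≤row 2≤cols = length-mono-⊆ (R! j) λ i∈R → ∈-∖⁺ i∈R λ i∈X →
    [ <⇒≱ 2≤row , <⇒≱ (2≤cols i∈X) ]′ (thin i∈R)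

  heavy-rows-avoid : ∀ {i Y} → 2 ≤ colWeight i → (∀ {j} → j ∈ Y → 2 ≤ rowWeight j) →
                     colWeight i ≤ length (C i ∖ Y)
  heavy-rows-avoid {i} {Y} 2≤col 2≤rows = length-mono-⊆ (C! i) λ j∈C → ∈-∖⁺ j∈C λ j∈Y →
    [ <⇒≱ (2≤rows j∈Y) , <⇒≱ 2≤col ]′ (thin (C⇒R j∈C))

  -- The heavier lines come first. At the two heads, `escape` is applied to the tails with the head
  -- weights as bounds, and by thinness the site sees all those points of A in addition to the
  -- tails.
  square : ∀ {X Y} → Ranked colWeight X → Ranked rowWeight Y →
           ∀ {i j} → i ∈ X → j ∈ Y → B (length X + length Y) i j
  square {i ∷ X} {j ∷ Y} rX@(ranked _ 2≤i maxi rX′) rY@(ranked _ 2≤j maxj rY′) (here refl) (here refl) =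
    B-grow (ranked⇒unique rX′) (ranked⇒unique rY′)
      (λ i′∈X → square rX′ rY i′∈X (here refl))
      (λ j′∈Y → B-mono (≤-reflexive (sym (+-suc (length X) (length Y)))) (square rX rY′ (here refl) j′∈Y))
      (out-mono (+-monoʳ-≤ (length X) (heavy-columns-avoid 2≤j (ranked⇒2≤ rX′)))
                (+-monoʳ-≤ (length Y) (heavy-rows-avoid 2≤i (ranked⇒2≤ rY′)))
        (escape {X} {Y} (λ {i′} i′∉X → ≤-trans (length-∖ (C i′) Y) (maxi i′∉X))
                        (λ {j′} j′∉Y → ≤-trans (length-∖ (R j′) X) (maxj j′∉Y))))
  square (ranked _ _ _ rX′) rY@(ranked _ _ _ _) (there i∈X) j∈Y =
    B-suc _ (square rX′ rY i∈X j∈Y)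
  square {i ∷ X} {j ∷ Y} rX@(ranked _ _ _ _) (ranked _ _ _ rY′) (here refl) (there j∈Y) =
    B-mono (s≤s (+-monoʳ-≤ (length X) (n≤1+n (length Y)))) (square rX rY′ (here refl) j∈Y)

  heavier : List ℕ → ℕ → List ℕ
  heavier Y k = filter (λ i → k <? length (C i ∖ Y)) cols

  heavier! : ∀ Y k → Unique (heavier Y k)
  heavier! Y k = filter⁺ (λ i → k <? length (C i ∖ Y)) cols!

  ∈-heavier⁻ : ∀ {Y k i} → i ∈ heavier Y k → k < length (C i ∖ Y)
  ∈-heavier⁻ {Y} {k} i∈ = proj₂ (∈-filter⁻ (λ i → k <? length (C i ∖ Y)) {xs = cols} i∈)

  ∈-heavier⁺ : ∀ {Y k i} → k < length (C i ∖ Y) → i ∈ heavier Y k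
  ∈-heavier⁺ {Y} {k} {i} k<len =
    let j , j∈ = nonempty⇒∃∈ (≤-<-trans z≤n k<len) in
    ∈-filter⁺ (λ i → k <? length (C i ∖ Y)) (R⊆cols (C⇒R (proj₁ (∈-∖⁻ (C i) Y j∈)))) k<len

  ∉-heavier : ∀ {Y k i} → i ∉ heavier Y k → length (C i ∖ Y) ≤ k
  ∉-heavier i∉ = ≮⇒≥ (i∉ ∘ ∈-heavier⁺)

  uncovered-column : ∀ {Y i j} → i ∈ R j → j ∉ Y → 0 < length (C i ∖ Y)
  uncovered-column i∈R j∉Y = ∈-length (∈-∖⁺ (R⇒C i∈R) j∉Y)

  -- Together with the rows `Y`, the columns of `heavier Y 0` meet every point of A.
  R-covered : ∀ {Y j} → j ∉ Y → length (R j ∖ heavier Y 0) ≤ 0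
  R-covered {Y} {j} j∉Y = no-elements⇒length≤0 λ i i∈ →
    let i∈R , i∉X = ∈-∖⁻ (R j) (heavier Y 0) i∈ in i∉X (∈-heavier⁺ (uncovered-column i∈R j∉Y))

  -- If column i has k points outside Y, only columns of weight at least 2 come before it when
  -- 1 ≤ k; when k = 0, they cover all the points outside Y.
  heaviest-row-grows : ∀ {Y j t i} → Unique Y → 2 ≤ rowWeight j →
    (∀ {j′} → j′ ∉ Y → rowWeight j′ ≤ rowWeight j) →
    (∀ {i′} → i′ ∈ heavier Y (length (C i ∖ Y)) → B t i′ j) →
    (∀ {j′} → j′ ∈ Y → B t i j′) → B (suc t) i j
  heaviest-row-grows {Y} {j} {t} {i} Y! 2≤j maxj row column with length (C i ∖ Y) in eq
  ... | zero = B-grow (heavier! Y 0) Y! row column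
    (out-mono (+-monoʳ-≤ _ z≤n) (+-monoʳ-≤ _ z≤n) (escape {heavier Y 0} {Y} ∉-heavier R-covered))
  ... | suc k = B-grow (heavier! Y (suc k)) Y! row column
    (out-mono (+-monoʳ-≤ _ (heavy-columns-avoid 2≤j 2≤)) (+-monoʳ-≤ _ (≤-reflexive (sym eq)))
      (escape {heavier Y (suc k)} {Y} ∉-heavier
        (λ {j′} j′∉Y → ≤-trans (length-∖ (R j′) _) (maxj j′∉Y))))
    where
    2≤ : ∀ {i′} → i′ ∈ heavier Y (suc k) → 2 ≤ colWeight i′
    2≤ {i′} i′∈ = ≤-trans (s≤s (s≤s z≤n)) (≤-trans (∈-heavier⁻ {Y} i′∈) (length-∖ (C i′) Y))

  heavier⊆heaviest : ∀ {X Y k} → (∀ {i} → i ∉ X → colWeight i ≤ 1) → 1 ≤ k → heavier Y k ⊆ X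
  heavier⊆heaviest {X} {Y} {k} light 1≤k {i} i∈ with i ∈? X
  ... | yes i∈X = i∈X
  ... | no i∉X  = contradiction (light i∉X)
    (<⇒≱ (≤-<-trans 1≤k (<-≤-trans (∈-heavier⁻ {Y} i∈) (length-∖ (C i) Y))))

  module _ {X : List ℕ} (hX : Heaviest colWeight s X) where

    X! : Unique X
    X! = ranked⇒unique (proj₁ hX)

    -- Inner induction, over column levels, within the induction of `rows-fill` over rows: given the
    -- heavier rows `Y`, row `j` is filled by decreasing number of points of column `i` outside `Y`,
    -- one step per level.
    next-row : ∀ {j Y} → Ranked rowWeight (j ∷ Y) → (∀ {i} → i ∈ X → B (s + s) i j) →
      (∀ n {i j′} → s ∸ length (C i ∖ Y) ≤ n → j′ ∈ Y → B (s + s + (length Y + n)) i j′) →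
      ∀ n {i} → s ∸ length (C i ∖ Y) ≤ n → B (s + s + suc (length Y + n)) i j
    next-row {j} {Y} rk@(ranked _ 2≤j maxj rkY) base previous n {i} level≤n =
      subst (λ t → B t i j) (sym (+-suc (s + s) (length Y + n))) occupied
      where
      t = s + s + (length Y + n)
      k = length (C i ∖ Y)

      base′ : ∀ {i′} → i′ ∈ X → B t i′ j
      base′ = B-mono (m≤m+n (s + s) _) ∘ base

      column : ∀ {j′} → j′ ∈ Y → B t i j′
      column = previous n level≤n

      occupied : B (suc t) i j
      occupied with s ≤? k | proj₂ hX
      ... | yes s≤k | inj₁ len≡s = B-grow X! (ranked⇒unique rkY) base′ column
        (out-mono (≤-trans (≤-reflexive (sym len≡s)) (m≤m+n (length X) _)) (≤-trans s≤k (m≤n+m k (length Y))) out-s)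
      -- Here `X` contains all columns of weight at least 2, hence all those that should precede
      -- column `i`.
      ... | yes s≤k | inj₂ (len<s , light) = heaviest-row-grows (ranked⇒unique rkY) 2≤j maxj
        (base′ ∘ heavier⊆heaviest light (≤-trans (≤-<-trans z≤n len<s) s≤k)) column
      ... | no s≰k | _ = heaviest-row-grows (ranked⇒unique rkY) 2≤j maxj (row n level≤n) column
        where
        row : ∀ n → s ∸ k ≤ n → ∀ {i′} → i′ ∈ heavier Y k → B (s + s + (length Y + n)) i′ j
        row zero    level≤0 i′∈ = contradiction (m∸n≡0⇒m≤n (n≤0⇒n≡0 level≤0)) s≰k
        row (suc n) level≤n {i′} i′∈ = subst (λ m → B (s + s + m) i′ j) (sym (+-suc (length Y) n))
          (next-row rk base previous n
            (≤-pred (<-≤-trans (∸-decreasing (∈-heavier⁻ {Y} i′∈) (≰⇒> s≰k)) level≤n)))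

    rows-fill : ∀ {Y} → Ranked rowWeight Y → (∀ {i j} → i ∈ X → j ∈ Y → B (s + s) i j) →
      ∀ n {i j} → s ∸ length (C i ∖ Y) ≤ n → j ∈ Y → B (s + s + (length Y + n)) i j
    rows-fill {j ∷ Y} rk@(ranked _ _ _ rkY) base n {i} level≤n j∈ = at j∈
      where
      previous : ∀ n {i j′} → s ∸ length (C i ∖ Y) ≤ n → j′ ∈ Y → B (s + s + (length Y + n)) i j′
      previous = rows-fill rkY (λ i∈X j′∈Y → base i∈X (there j′∈Y))

      -- Levels relative to `Y` are at least those relative to `j ∷ Y`, so the time allowance `n`
      -- still suffices.
      level≤n′ : s ∸ length (C i ∖ Y) ≤ n
      level≤n′ = ≤-trans (∸-monoʳ-≤ s (length-∖-antitone (C! i) there)) level≤n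

      at : ∀ {j′} → j′ ∈ j ∷ Y → B (s + s + suc (length Y + n)) i j′
      at (here refl)  = next-row rk (λ i∈X → base i∈X (here refl)) previous n level≤n′
      at (there j′∈Y) = B-mono (+-monoʳ-≤ (s + s) (n≤1+n _)) (previous n level≤n′ j′∈Y)

  heaviest-length : ∀ {f X} → Heaviest f s X → length X ≤ s
  heaviest-length (_ , inj₁ len≡s)       = ≤-reflexive len≡s
  heaviest-length (_ , inj₂ (len<s , _)) = <⇒≤ len<s

  -- Time `s + s` for the square, at most `s` for the rows of `Y`, and `s` for the truncated levels.
  heaviest-rows-full : ∀ {X Y} → Heaviest colWeight s X → Heaviest rowWeight s Y →
    ∀ {i j} → j ∈ Y → B (s + s + (s + s)) i j
  heaviest-rows-full {X} {Y} hX hY {i} {j} j∈Y =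
    B-mono (+-monoʳ-≤ (s + s) (+-monoˡ-≤ s (heaviest-length hY)))
      (rows-fill hX (proj₁ hY)
        (λ i∈X j∈Y → B-mono (+-mono-≤ (heaviest-length hX) (heaviest-length hY))
                       (square (proj₁ hX) (proj₁ hY) i∈X j∈Y))
        s (m∸n≤m s (length (C i ∖ Y))) j∈Y)

  -- Completion when all rows outside `Y` are light

  module Exhausted {X Y : List ℕ} (hX : Heaviest colWeight s X) (Y! : Unique Y)
    (light-rows : ∀ {j} → j ∉ Y → rowWeight j ≤ 1) {t₀ : ℕ}
    (X-full : ∀ {i j} → i ∈ X → B t₀ i j) (Y-full : ∀ {i j} → j ∈ Y → B t₀ i j) where

    next-column : ∀ {t i} → t₀ ≤ t → 1 ≤ length (C i ∖ Y) →
      (∀ {i′ j} → i′ ∈ heavier Y (length (C i ∖ Y)) → B t i′ j) → ∀ {j} → B (2 + t) i j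
    next-column {t} {i} t₀≤t 1≤k full = B-grow (heavier! Y k) touched!
        (B-suc _ ∘ full) touched-row
        (out-mono (+-monoʳ-≤ (length X′) z≤n) (+-monoʳ-≤ (length touched) z≤n)
          -- Every point of A outside `X′` lies on a touched row, so both residual bounds are 0.
          (escape {X′} {touched} columns-covered rows-covered))
      where
      k = length (C i ∖ Y)
      X′ = heavier Y k
      touched = filter (λ j → 0 <? length (R j ∖ X′)) rows
      touched! = filter⁺ (λ j → 0 <? length (R j ∖ X′)) rows!

      ∈-touched⁺ : ∀ {i′ j} → i′ ∈ R j → i′ ∉ X′ → j ∈ touched
      ∈-touched⁺ i′∈R i′∉X′ =
        ∈-filter⁺ (λ j → 0 <? length (R j ∖ X′)) (C⊆rows (R⇒C i′∈R)) (∈-length (∈-∖⁺ i′∈R i′∉X′))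

      columns-covered : ∀ {i′} → i′ ∉ X′ → length (C i′ ∖ touched) ≤ 0
      columns-covered {i′} i′∉X′ = no-elements⇒length≤0 λ j j∈ →
        let j∈C , j∉ = ∈-∖⁻ (C i′) touched j∈ in j∉ (∈-touched⁺ (C⇒R j∈C) i′∉X′)

      rows-covered : ∀ {j} → j ∉ touched → length (R j ∖ X′) ≤ 0
      rows-covered {j} j∉ = no-elements⇒length≤0 λ i′ i′∈ →
        let i′∈R , i′∉X′ = ∈-∖⁻ (R j) X′ i′∈ in j∉ (∈-touched⁺ i′∈R i′∉X′)

      touched-row : ∀ {j} → j ∈ touched → B (suc t) i j
      -- A touched row offers `X′` plus one more point, which matches `escape` with row bound 1
      -- outside `Y`.
      touched-row {j} j∈ = B-grow (heavier! Y k) Y! full (B-mono t₀≤t ∘ Y-full)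
        (out-mono (+-monoʳ-≤ (length X′) (proj₂ (∈-filter⁻ (λ j → 0 <? length (R j ∖ X′)) {xs = rows} j∈))) ≤-refl
          (escape {X′} {Y} ∉-heavier (λ {j′} j′∉Y → ≤-trans (length-∖ (R j′) X′) (light-rows j′∉Y))))

    columns-fill : ∀ n {i j} → 1 ≤ length (C i ∖ Y) → s ∸ length (C i ∖ Y) ≤ n →
                   B (2 + (n + n) + t₀) i j
    columns-fill n {i} {j} 1≤k level≤n with s ≤? length (C i ∖ Y) | proj₂ hX
    ... | yes s≤k | inj₁ len≡s = B-mono (s≤s (m≤n+m t₀ (suc (n + n)))) (B-grow
      (ranked⇒unique (proj₁ hX)) Y! X-full Y-full
      (out-mono (≤-trans (≤-reflexive (sym len≡s)) (m≤m+n (length X) _)) (≤-trans s≤k (m≤n+m _ (length Y))) out-s))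
    ... | yes s≤k | inj₂ (_ , light) = next-column (m≤n+m t₀ (n + n)) 1≤k
      (B-mono (m≤n+m t₀ (n + n)) ∘ X-full ∘ heavier⊆heaviest light 1≤k)
    columns-fill zero 1≤k level≤0 | no s≰k | _ = contradiction (m∸n≡0⇒m≤n (n≤0⇒n≡0 level≤0)) s≰k
    columns-fill (suc n) {i} {j} 1≤k level≤n | no s≰k | _ =
      subst (λ m → B (2 + (suc m + t₀)) i j) (sym (+-suc n n))
        (next-column (m≤n+m t₀ (2 + (n + n))) 1≤k λ i′∈ →
          let k<k′ = ∈-heavier⁻ {Y} i′∈ in
          columns-fill n (≤-trans (s≤s z≤n) k<k′)
            (≤-pred (<-≤-trans (∸-decreasing k<k′ (≰⇒> s≰k)) level≤n)))

    -- Once the columns having a point outside `Y` are full, they and the rows `Y` cover A, so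
    -- `escape` with zero bounds fills the plane in one more step.
    exhausted-full : Full (B (3 + (s + s) + t₀))
    exhausted-full i j = B-grow (heavier! Y 0) Y!
      (λ {i′} i′∈ → columns-fill s (∈-heavier⁻ {Y} i′∈) (m∸n≤m s (length (C i′ ∖ Y))))
      (B-mono (m≤n+m t₀ (2 + (s + s))) ∘ Y-full)
      (out-mono (+-monoʳ-≤ (length (heavier Y 0)) z≤n) (+-monoʳ-≤ (length Y) z≤n)
        (escape {heavier Y 0} {Y} ∉-heavier R-covered))

thin-full : ∀ {s} (G : ThinGrowth s) → Full (ThinGrowth.B G (8 * s + 2))
thin-full {s} G = conclude
  where
  open ThinGrowth G
  open ThinFilling G
  module Gᵀ = ThinFilling (transpose-thin G)

  heaviest-cols : ∃ (Heaviest colWeight s)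
  heaviest-cols = heaviest colWeight cols (λ 0<w → R⊆cols (C⇒R (proj₂ (nonempty⇒∃∈ 0<w)))) s

  heaviest-rows : ∃ (Heaviest rowWeight s)
  heaviest-rows = heaviest rowWeight rows (λ 0<w → C⊆rows (R⇒C (proj₂ (nonempty⇒∃∈ 0<w)))) s

  X Y : List ℕ
  X = proj₁ heaviest-cols
  Y = proj₁ heaviest-rows

  hX = proj₂ heaviest-cols
  hY = proj₂ heaviest-rows

  Y-full : ∀ {i j} → j ∈ Y → B (s + s + (s + s)) i j
  Y-full = heaviest-rows-full hX hY

  X-full : ∀ {i j} → i ∈ X → B (s + s + (s + s)) i j
  X-full = Gᵀ.heaviest-rows-full hY hX

  -- The total `6 * s + 3` fits below `8 * s + 2` exactly when `s` is positive; a selection shorter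
  -- than `s` guarantees this.
  late : 0 < s → 3 + (s + s) + (s + s + (s + s)) ≤ 8 * s + 2
  late 0<s = begin
    3 + (s + s) + (s + s + (s + s))      ≡⟨ solve 1 (λ x → con 3 :+ (x :+ x) :+ (x :+ x :+ (x :+ x)) := con 1 :+ (con 6 :* x :+ con 2)) refl s ⟩
    1 + (6 * s + 2)                      ≤⟨ +-monoˡ-≤ (6 * s + 2) (≤-trans 0<s (m≤m+n s s)) ⟩
    s + s + (6 * s + 2)                  ≡⟨ solve 1 (λ x → x :+ x :+ (con 6 :* x :+ con 2) := con 8 :* x :+ con 2) refl s ⟩
    8 * s + 2                            ∎
    where
    open ≤-Reasoning
    open +-*-Solver

  early : suc (s + s + (s + s)) ≤ 8 * s + 2
  early = begin
    suc (s + s + (s + s))                         ≤⟨ m≤m+n _ (suc (4 * s)) ⟩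
    suc (s + s + (s + s)) + suc (4 * s)           ≡⟨ solve 1 (λ x → con 1 :+ (x :+ x :+ (x :+ x)) :+ (con 1 :+ con 4 :* x) := con 8 :* x :+ con 2) refl s ⟩
    8 * s + 2                                     ∎
    where
    open ≤-Reasoning
    open +-*-Solver

  conclude : Full (B (8 * s + 2))
  conclude i j with proj₂ hX | proj₂ hY
  ... | inj₁ lenX≡s | inj₁ lenY≡s = B-mono early (B-grow
    (ranked⇒unique (proj₁ hX)) (ranked⇒unique (proj₁ hY)) X-full Y-full
    (out-mono (≤-trans (≤-reflexive (sym lenX≡s)) (m≤m+n _ _)) (≤-trans (≤-reflexive (sym lenY≡s)) (m≤m+n _ _)) out-s))
  ... | _ | inj₂ (len<s , light) = B-mono (late (≤-<-trans z≤n len<s))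
    (Exhausted.exhausted-full hX (ranked⇒unique (proj₁ hY)) light X-full Y-full i j)
  ... | inj₂ (len<s , light) | inj₁ _ = B-mono (late (≤-<-trans z≤n len<s))
    (Gᵀ.Exhausted.exhausted-full hY (ranked⇒unique (proj₁ hX)) light Y-full X-full j i)

-- The complement of a zero-set

-- Non-membership in positive form: for each rectangle, the same row-or-column alternative as in the
-- update rule.
Outside : IndexSet → ℕ → ℕ → Set
Outside I a b = All (λ p → proj₁ p ≤ a ⊎ proj₂ p ≤ b) I

outside-mono : ∀ {I a a′ b b′} → a ≤ a′ → b ≤ b′ → Outside I a b → Outside I a′ b′
outside-mono a≤a′ b≤b′ = All-map (map-⊎ (λ p → ≤-trans p a≤a′) (λ q → ≤-trans q b≤b′))

¬InZ⇒outside : ∀ I {a b} → ¬ InZ I a b → Outside I a b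
¬InZ⇒outside I {a} {b} ∉Z = All-map outside (¬Any⇒All¬ I ∉Z)
  where
  outside : ∀ {p} → ¬ (a < proj₁ p × b < proj₂ p) → proj₁ p ≤ a ⊎ proj₂ p ≤ b
  outside {x , y} ¬both with a <? x
  ... | yes a<x = inj₂ (≮⇒≥ λ b<y → ¬both (a<x , b<y))
  ... | no a≮x  = inj₁ (≮⇒≥ a≮x)

-- A rectangle containing `(s , s)` would contain the whole square of side `s + 1`.
diagonal-outside : ∀ {I s} → IsS I s → Outside I s s
diagonal-outside {I} (_ , ¬square) = ¬InZ⇒outside I λ s∈Z → ¬square λ x y x≤s y≤s →
  Any-map (λ (s<a , s<b) → ≤-trans x≤s s<a , ≤-trans y≤s s<b) s∈Z

nonempty⇒s>0 : ∀ {I s} → NonemptyZ I → IsS I s → 0 < s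
nonempty⇒s>0 {s = suc s} _ _ = s≤s z≤n
nonempty⇒s>0 {s = zero} (x , y , xy∈Z) (_ , ¬square) = contradiction
  (λ x′ y′ x′<1 y′<1 → Any-map (λ (x<a , y<b) → ≤-trans x′<1 (≤-trans (s≤s z≤n) x<a) , ≤-trans y′<1 (≤-trans (s≤s z≤n) y<b)) xy∈Z)
  ¬square

-- The enhanced dynamics satisfies the growth axioms

module _ {I : IndexSet} {r c : ℕ → ℕ} (r-dec : WeaklyDecreasing r) (c-dec : WeaklyDecreasing c) where

  -- A corner inside 𝓩 blocks its whole upper right quadrant: the lines meeting it there
  -- carry at most i₀ (resp. j₀) occupied points outside it.
  blocked-quadrant : ∀ {i₀ j₀} → InZ I (i₀ + r j₀) (j₀ + c i₀) →
    ∀ t {i j} → i₀ ≤ i → j₀ ≤ j → ¬ EnIter I r c t i j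
  blocked-quadrant corner (suc t) i₀≤i j₀≤j (inj₁ old) = blocked-quadrant corner t i₀≤i j₀≤j old
  blocked-quadrant {i₀} {j₀} corner (suc t) {i} {j} i₀≤i j₀≤j (inj₂ new)
    with find corner
  ... | (a , b) , p∈I , a> , b> with lookup new p∈I
  ...   | inj₁ (xs , xs! , all , a≤) = <⇒≱ a> (begin
    a                     ≤⟨ m≤n+m∸n a (r j) ⟩
    r j + (a ∸ r j)       ≤⟨ +-mono-≤ (decreasing⇒antitone r-dec j₀≤j) (≤-trans a≤ short) ⟩
    r j₀ + i₀             ≡⟨ +-comm (r j₀) i₀ ⟩
    i₀ + r j₀             ∎)
    where
    open ≤-Reasoning
    short : length xs ≤ i₀
    short = subst (length xs ≤_) (length-upTo i₀) (length-mono-⊆ xs! λ x∈ → ∈-upTo⁺ (≰⇒> λ i₀≤x →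
      blocked-quadrant corner t i₀≤x j₀≤j (lookup all x∈)))
  ...   | inj₂ (ys , ys! , all , b≤) = <⇒≱ b> (begin
    b                     ≤⟨ m≤n+m∸n b (c i) ⟩
    c i + (b ∸ c i)       ≤⟨ +-mono-≤ (decreasing⇒antitone c-dec i₀≤i) (≤-trans b≤ short) ⟩
    c i₀ + j₀             ≡⟨ +-comm (c i₀) j₀ ⟩
    j₀ + c i₀             ∎)
    where
    open ≤-Reasoning
    short : length ys ≤ j₀
    short = subst (length ys ≤_) (length-upTo j₀) (length-mono-⊆ ys! λ y∈ → ∈-upTo⁺ (≰⇒> λ j₀≤y →
      blocked-quadrant corner t i₀≤i j₀≤y (lookup all y∈)))

enhanced-bound : ∀ I s → IsS I s → MuEnAtMost I (4 * s + 1)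
enhanced-bound I s isS r c (r-dec , c-dec , _ , _ , spans) = enhanced-full record
  { out = Outside I ; out-mono = outside-mono ; out-s = diagonal-outside isS
  ; r = r ; c = c ; r-dec = r-dec ; c-dec = c-dec
  ; B = EnIter I r c ; B-suc = λ _ → inj₁
  ; B-grow = λ {t} {i} {j} {a} {b} row column → inj₂ ∘ All-map (map-⊎
      (λ le → upTo a , upTo⁺ a , tabulate (row ∘ ∈-upTo⁻) , fits a (r j) le)
      (λ le → upTo b , upTo⁺ b , tabulate (column ∘ ∈-upTo⁻) , fits b (c i) le))
  -- A corner inside the zero-set would keep `(i , j)` itself empty forever, against spanning.
  ; corner = λ i j → ¬InZ⇒outside I λ ∈Z →
      let t , ij∈ = spans i j in blocked-quadrant r-dec c-dec ∈Z t ≤-refl ≤-refl ij∈ }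
  where
  fits : ∀ {m} a k → m ≤ a + k → m ∸ k ≤ length (upTo a)
  fits {m} a k m≤a+k = begin
    m ∸ k            ≤⟨ m≤n+o⇒m∸n≤o m k (≤-trans m≤a+k (≤-reflexive (+-comm a k))) ⟩
    a                ≡⟨ sym (length-upTo a) ⟩
    length (upTo a)  ∎
    where open ≤-Reasoning

-- The regular dynamics from a thin set satisfies the growth axioms

module ThinSet (A : List Point) where

  cols rows : List ℕ
  cols = deduplicate _≟_ (map proj₁ A)
  rows = deduplicate _≟_ (map proj₂ A)

  R C : ℕ → List ℕ
  R j = filter (λ i → (i , j) ∈ᵖ? A) cols
  C i = filter (λ j → (i , j) ∈ᵖ? A) rows

  A⇒cols : ∀ {i j} → (i , j) ∈ A → i ∈ cols
  A⇒cols = ∈-deduplicate⁺ _≟_ ∘ ∈-map⁺ proj₁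

  A⇒rows : ∀ {i j} → (i , j) ∈ A → j ∈ rows
  A⇒rows = ∈-deduplicate⁺ _≟_ ∘ ∈-map⁺ proj₂

  A⇒R : ∀ {i j} → (i , j) ∈ A → i ∈ R j
  A⇒R {j = j} p∈A = ∈-filter⁺ (λ i → (i , j) ∈ᵖ? A) (A⇒cols p∈A) p∈A

  A⇒C : ∀ {i j} → (i , j) ∈ A → j ∈ C i
  A⇒C {i} p∈A = ∈-filter⁺ (λ j → (i , j) ∈ᵖ? A) (A⇒rows p∈A) p∈A

  R⇒A : ∀ {i j} → i ∈ R j → (i , j) ∈ A
  R⇒A {j = j} i∈R = proj₂ (∈-filter⁻ (λ i → (i , j) ∈ᵖ? A) {xs = cols} i∈R)

  C⇒A : ∀ {i j} → j ∈ C i → (i , j) ∈ A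
  C⇒A {i} j∈C = proj₂ (∈-filter⁻ (λ j → (i , j) ∈ᵖ? A) {xs = rows} j∈C)

  R! : ∀ j → Unique (R j)
  R! j = filter⁺ (λ i → (i , j) ∈ᵖ? A) (deduplicate-! (map proj₁ A))

  C! : ∀ i → Unique (C i)
  C! i = filter⁺ (λ j → (i , j) ∈ᵖ? A) (deduplicate-! (map proj₂ A))

  length-R : ∀ i j → length (R j) ≤ rowCount (i , j) A
  length-R i j = ≤-trans
    (length-mono-⊆ (R! j) λ i∈R → ∈-map⁺ proj₁ (∈-filter⁺ (λ p → proj₂ p ≟ j) (R⇒A i∈R) refl))
    (≤-reflexive (length-map proj₁ (filter (λ p → proj₂ p ≟ j) A)))

  length-C : ∀ i j → length (C i) ≤ colCount (i , j) A
  length-C i j = ≤-trans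
    (length-mono-⊆ (C! i) λ j∈C → ∈-map⁺ proj₂ (∈-filter⁺ (λ p → proj₁ p ≟ i) (C⇒A j∈C) refl))
    (≤-reflexive (length-map proj₂ (filter (λ p → proj₁ p ≟ i) A)))

  module _ (I : IndexSet) where

    -- Induction on time: while occupation stays within A and the lines of `X` and `Y`, a new site
    -- off these lines sees at most `length X + l` points in its row and `length Y + k` in its
    -- column, a pair inside the zero-set.
    confined : ∀ {X Y k l} → (∀ {i} → i ∉ X → length (C i ∖ Y) ≤ k) →
      (∀ {j} → j ∉ Y → length (R j ∖ X) ≤ l) → InZ I (length X + l) (length Y + k) →
      ∀ t {i j} → Iter I (ListSet A) t i j → (i , j) ∈ A ⊎ (i ∈ X ⊎ j ∈ Y)
    confined C≤k R≤l ∈Z zero p∈A = inj₁ p∈A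
    confined C≤k R≤l ∈Z (suc t) (inj₁ old) = confined C≤k R≤l ∈Z t old
    confined {X} {Y} C≤k R≤l ∈Z (suc t) {i} {j} (inj₂ new) with i ∈? X | j ∈? Y
    ... | yes i∈X | _       = inj₂ (inj₁ i∈X)
    ... | no _    | yes j∈Y = inj₂ (inj₂ j∈Y)
    ... | no i∉X  | no j∉Y with find ∈Z
    ...   | (a , b) , p∈I , a> , b> with lookup new p∈I
    ...     | inj₁ (xs , xs! , all , a≤) = contradiction a> (≤⇒≯ (≤-trans a≤ (≤-trans
      (length-mono-⊆ xs! sub) (≤-trans (≤-reflexive (length-++ X)) (+-monoʳ-≤ (length X) (R≤l j∉Y))))))
      where
      sub : xs ⊆ X ++ (R j ∖ X)
      sub {x} x∈ with x ∈? X | confined {X} {Y} C≤k R≤l ∈Z t (lookup all x∈)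
      ... | yes x∈X | _                = ∈-++⁺ˡ x∈X
      ... | no x∉X | inj₁ p∈A          = ∈-++⁺ʳ X (∈-∖⁺ (A⇒R p∈A) x∉X)
      ... | no x∉X | inj₂ (inj₁ x∈X)   = contradiction x∈X x∉X
      ... | no x∉X | inj₂ (inj₂ j∈Y)   = contradiction j∈Y j∉Y
    ...     | inj₂ (ys , ys! , all , b≤) = contradiction b> (≤⇒≯ (≤-trans b≤ (≤-trans
      (length-mono-⊆ ys! sub) (≤-trans (≤-reflexive (length-++ Y)) (+-monoʳ-≤ (length Y) (C≤k i∉X))))))
      where
      sub : ys ⊆ Y ++ (C i ∖ Y)
      sub {y} y∈ with y ∈? Y | confined {X} {Y} C≤k R≤l ∈Z t (lookup all y∈)
      ... | yes y∈Y | _                = ∈-++⁺ˡ y∈Y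
      ... | no y∉Y | inj₁ p∈A          = ∈-++⁺ʳ Y (∈-∖⁺ (A⇒C p∈A) y∉Y)
      ... | no y∉Y | inj₂ (inj₁ i∈X)   = contradiction i∈X i∉X
      ... | no y∉Y | inj₂ (inj₂ y∈Y)   = contradiction y∈Y y∉Y

    spans⇒escape : Spans I A → ∀ {X Y k l} → (∀ {i} → i ∉ X → length (C i ∖ Y) ≤ k) →
      (∀ {j} → j ∉ Y → length (R j ∖ X) ≤ l) → Outside I (length X + l) (length Y + k)
    spans⇒escape spans {X} {Y} C≤k R≤l = ¬InZ⇒outside I λ ∈Z →
      -- A column missing both `X` and A, crossed with a row missing `Y`, gives a site that would
      -- never be occupied.
      let i , i∉ = fresh (X ++ cols)
          j , j∉ = fresh Y
          t , ij∈ = spans i j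
      in [ i∉ ∘ ∈-++⁺ʳ X ∘ A⇒cols , [ i∉ ∘ ∈-++⁺ˡ , j∉ ]′ ]′ (confined C≤k R≤l ∈Z t ij∈)

    A⊆Iter : ∀ t {i j} → (i , j) ∈ A → Iter I (ListSet A) t i j
    A⊆Iter zero p∈A    = p∈A
    A⊆Iter (suc t) p∈A = inj₁ (A⊆Iter t p∈A)

    extend : ∀ {P : ℕ → Set} {X L m} → Unique X → Unique L → (∀ {x} → x ∈ X → P x) → (∀ {x} → x ∈ L → P x) →
      m ≤ length X + length (L ∖ X) → Σ (List ℕ) λ l → Unique l × All P l × m ≤ length l
    extend {X = X} {L} X! L! onX onL m≤ = X ++ (L ∖ X) ,
      ++⁺ X! (∖-unique X L!) (λ (x∈X , x∈L∖X) → proj₂ (∈-∖⁻ L X x∈L∖X) x∈X) ,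
      tabulate ([ onX , onL ∘ proj₁ ∘ ∈-∖⁻ L X ]′ ∘ ∈-++⁻ X) ,
      ≤-trans m≤ (≤-reflexive (sym (length-++ X)))

    thin-bound : ∀ s → IsS I s → Thin A → Spans I A → Full (Iter I (ListSet A) (8 * s + 2))
    thin-bound s isS (_ , thin) spans = thin-full record
      { out = Outside I ; out-mono = outside-mono ; out-s = diagonal-outside isS
      ; R = R ; C = C ; R! = R! ; C! = C!
      ; R⇒C = A⇒C ∘ R⇒A ; C⇒R = A⇒R ∘ C⇒A
      ; thin = λ {i} {j} i∈R → map-⊎
          (λ eq → ≤-trans (length-R i j) (≤-reflexive eq))
          (λ eq → ≤-trans (length-C i j) (≤-reflexive eq)) (lookup thin (R⇒A i∈R))
      ; cols = cols ; rows = rows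
      ; cols! = deduplicate-! (map proj₁ A) ; rows! = deduplicate-! (map proj₂ A)
      ; R⊆cols = A⇒cols ∘ R⇒A ; C⊆rows = A⇒rows ∘ C⇒A
      ; B = Iter I (ListSet A) ; B-suc = λ _ → inj₁
      ; B-grow = λ {t} {i} {j} {X} {Y} X! Y! row column → inj₂ ∘ All-map (map-⊎
          (extend {λ i′ → Iter I (ListSet A) t i′ j} X! (R! j) row (A⊆Iter t ∘ R⇒A))
          (extend {λ j′ → Iter I (ListSet A) t i j′} Y! (C! i) column (A⊆Iter t ∘ C⇒A)))
      ; escape = λ {X} {Y} → spans⇒escape spans {X} {Y} }

-- Linear bounds and examples for the suprema

linear-bound : ∀ {k m s} → 0 < s → k * s + m ≤ (k + m) * s
linear-bound {k} {m} {s@(suc _)} _ = begin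
  k * s + m      ≤⟨ +-monoʳ-≤ (k * s) (m≤m*n m s) ⟩
  k * s + m * s  ≡⟨ sym (*-distribʳ-+ s k m) ⟩
  (k + m) * s    ∎
  where open ≤-Reasoning

single : ∀ {P : ℕ → Set} {x} → P x → Σ (List ℕ) λ l → Unique l × All P l × 1 ≤ length l
single {x = x} px = x ∷ [] , [] ∷ [] , px ∷ [] , ≤-refl

unit-indicator : ℕ → ℕ
unit-indicator zero    = 1
unit-indicator (suc _) = 0

-- The enhancement fills row 0 in one step; every column then has an occupied site, which fills the
-- plane in the second.
unit-indicator-admissible : AdmissibleEn ((1 , 1) ∷ []) unit-indicator (λ _ → 0)
unit-indicator-admissible =
  (λ { zero → z≤n ; (suc _) → z≤n }) , (λ _ → z≤n) ,
  (1 , λ { (suc _) _ → refl }) , (0 , λ _ _ → refl) ,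
  λ i j → 2 , inj₂ (inj₂ (single {x = 0} (inj₂ (inj₁ ([] , [] , [] , z≤n) ∷ []))) ∷ [])

origin-spans : Spans ((1 , 1) ∷ []) ((0 , 0) ∷ [])
origin-spans i j = 2 , inj₂ (inj₂ (single {x = 0} (inj₂ (inj₁ (single {x = 0} (here refl)) ∷ []))) ∷ [])

theorem1p3 : ((I : IndexSet) → ValidIndexSet I → (s : ℕ) → IsS I s →
    MuEnAtMost I (4 * s + 1) × MuThAtMost I (8 * s + 2))
    × ((Σ ℕ λ C → (I : IndexSet) → ValidIndexSet I → NonemptyZ I →
    (s : ℕ) → IsS I s → MuEnAtMost I (C * s))
    × (Σ IndexSet λ I → ValidIndexSet I × NonemptyZ I ×
    (Σ (ℕ → ℕ) λ r → Σ (ℕ → ℕ) λ c → AdmissibleEn I r c)))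
    × ((Σ ℕ λ C → (I : IndexSet) → ValidIndexSet I → NonemptyZ I →
    (s : ℕ) → IsS I s → MuThAtMost I (C * s))
    × (Σ IndexSet λ I → ValidIndexSet I × NonemptyZ I ×
    (Σ (List Point) λ A → Thin A × Spans I A)))
theorem1p3 =
  (λ I _ s isS → enhanced-bound I s isS , λ A → ThinSet.thin-bound A I s isS) ,
  -- A nonempty zero-set has `s` at least 1, so the additive constants are absorbed: 5 = 4 + 1, and
  -- below 10 = 8 + 2.
  ((5 , λ I _ ne s isS r c adm i j →
     monotone {λ t → EnIter I r c t i j} (λ _ → inj₁)
       (linear-bound {4} {1} (nonempty⇒s>0 ne isS)) (enhanced-bound I s isS r c adm i j)) ,
   -- Spanning times are at least 1 by definition, so one spanning example makes the supremum
   -- positive.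
   ((1 , 1) ∷ [] , (≤-refl , ≤-refl) ∷ [] , (0 , 0 , here (≤-refl , ≤-refl)) ,
    unit-indicator , (λ _ → 0) , unit-indicator-admissible)) ,
  ((10 , λ I _ ne s isS A thin spans i j →
     monotone {λ t → Iter I (ListSet A) t i j} (λ _ → inj₁)
       (linear-bound {8} {2} (nonempty⇒s>0 ne isS)) (ThinSet.thin-bound A I s isS thin spans i j)) ,
   ((1 , 1) ∷ [] , (≤-refl , ≤-refl) ∷ [] , (0 , 0 , here (≤-refl , ≤-refl)) ,
    (0 , 0) ∷ [] , ([] ∷ [] , inj₁ refl ∷ []) , origin-spans))
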